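{- Let $p$ be a prime, $r\ge1$, $G=\mathbb{Z}_{p^r}$, and let $H$ be a finite abelian group of $p$-rank $t\ge 1$. Let $k\ge t+2$ be an integer and $f:G\to H$ any function. If $f$ passes $\mathsf{Test\_ker}_k(G,H)$ with probability $\delta_k$, then \[\Bigl(\frac{(p-1)^2}{p^2}\,\delta_k\Bigr)^{\frac{1}{k-t-1}} \le \max_{\varphi\in\mathrm{Hom}(G,H)}\mathrm{agr}(f,\varphi) \le \Bigl(\frac{p^2}{p^2-1}\,\delta_k\Bigr)^{\frac1k}.\]
   Context: For finite groups $G,H$ with $H$ abelian, $\mathrm{Hom}(G,H)$ (the group homomorphisms $G\to H$) is an abelian group under pointwise multiplication. $\mathrm{agr}(f,\varphi)=\Pr_{x\sim G}[f(x)=\varphi(x)]$, $x$ uniform. For $\vec x=(x_1,\dots,x_k)\in G^k$ let $\Gamma_{\vec x}:\mathrm{Hom}(G,H)\to H^k$, $\Gamma_{\vec x}(\varphi)=(\varphi(x_1),\dots,\varphi(x_k))$ (a group homomorphism), let $\mathsf{H}_{\vec x}$ be its image, and $\mathcal{G}_k=\{\vec x\in G^k:\mathsf{H}_{\vec x}\ne H^k\}$. The test $\mathsf{Test\_ker}_k(G,H)$, given oracle access to $f:G\to H$: sample $\vec x\in\mathcal{G}_k$ with probability proportional to $|\ker\Gamma_{\vec x}|$; accept iff $(f(x_1),\dots,f(x_k))\in\mathsf{H}_{\vec x}$. The $p$-rank of a finite abelian group is the number of cyclic summands of $p$-power order in its decomposition into cyclic groups of prime-power order. -}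

module Defs where

open import Level using (0ℓ)
open import Data.Nat as ℕ using (ℕ; zero; suc; NonZero)
open import Data.Nat.DivMod using (_%_; m%n<n)
open import Data.Nat.Primality using (Prime)
open import Data.Fin using (Fin; toℕ; fromℕ<)
open import Data.Fin.Properties using () renaming (_≟_ to _≟F_)
open import Data.Vec as Vec using (Vec; []; _∷_)
import Data.Vec.Properties as VecP
open import Data.List as List using (List; []; _∷_; length; filter; concatMap; allFin)
open import Data.Nat.ListAction using (sum)
open import Data.List.Relation.Unary.All using (all?)
open import Data.List.Relation.Unary.Any using (any?)
open import Data.Product using (Σ; ∃; _×_; _,_)
open import Data.Unit using (⊤; tt)
open import Data.Integer using (+_)
open import Data.Rational as ℚ using (ℚ; _/_)
open import Relation.Binary.PropositionalEquality using (_≡_)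
open import Relation.Binary.Definitions using (DecidableEquality)
open import Relation.Nullary using (Dec; yes; no; ¬_)
open import Relation.Nullary.Decidable using (¬?; _×-dec_)
open import Algebra.Structures using (IsAbelianGroup)
open import Function.Definitions using (Bijective)

record FinAbGroup : Set₁ where
  field
    Carrier        : Set
    _∙_            : Carrier → Carrier → Carrier
    ε              : Carrier
    _⁻¹            : Carrier → Carrier
    isAbelianGroup : IsAbelianGroup _≡_ _∙_ ε _⁻¹
    _≟_            : DecidableEquality Carrier
    size           : ℕ
    enum           : Fin size → Carrier
    enum-bij       : Bijective _≡_ _≡_ enum

  elements : List Carrier
  elements = List.map enum (allFin size)

_+ₘ_ : ∀ {n} → Fin n → Fin n → Fin n
_+ₘ_ {suc n} i j = fromℕ< (m%n<n (toℕ i ℕ.+ toℕ j) (suc n))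

Prod : List ℕ → Set
Prod []       = ⊤
Prod (q ∷ qs) = Fin q × Prod qs

_+ᴾ_ : ∀ {qs} → Prod qs → Prod qs → Prod qs
_+ᴾ_ {[]}     _        _        = tt
_+ᴾ_ {q ∷ qs} (a , as) (b , bs) = (a +ₘ b) , (as +ᴾ bs)

IsPrimePower : ℕ → Set
IsPrimePower q = Σ ℕ λ ℓ → Σ ℕ λ e → Prime ℓ × (e ℕ.≥ 1) × (q ≡ ℓ ℕ.^ e)

IsPowerOf : ℕ → ℕ → Set
IsPowerOf p q = Σ ℕ λ e → (e ℕ.≥ 1) × (q ≡ p ℕ.^ e)

record PrimaryDecomposition (H : FinAbGroup) (qs : List ℕ) : Set where
  open FinAbGroup H
  field
    primePowers : Data.List.Relation.Unary.All.All IsPrimePower qs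
    iso         : Prod qs → Carrier
    iso-hom     : ∀ a b → iso (a +ᴾ b) ≡ iso a ∙ iso b
    iso-bij     : Bijective _≡_ _≡_ iso

-- the p-rank read off a decomposition: number of cyclic summands of p-power order
data PRank (p : ℕ) : List ℕ → ℕ → Set where
  []     : PRank p [] 0
  _∷ᵖ_   : ∀ {q qs t} → IsPowerOf p q → PRank p qs t → PRank p (q ∷ qs) (suc t)
  _∷ⁿ_   : ∀ {q qs t} → ¬ IsPowerOf p q → PRank p qs t → PRank p (q ∷ qs) t

allVecs : ∀ {A : Set} → List A → (k : ℕ) → List (Vec A k)
allVecs xs zero    = [] ∷ []
allVecs xs (suc k) = concatMap (λ x → List.map (x ∷_) (allVecs xs k)) xs

count : ∀ {A : Set} {P : A → Set} → ((a : A) → Dec (P a)) → List A → ℕ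
count P? xs = length (filter P? xs)

-- division into ℚ (the denominator is never 0 where used; x ÷ 0 = 0 by convention)
_÷ℕ_ : ℕ → ℕ → ℚ
x ÷ℕ zero  = ℚ.0ℚ
x ÷ℕ suc d = (+ x) / suc d

_^ℚ_ : ℚ → ℕ → ℚ
a ^ℚ zero  = ℚ.1ℚ
a ^ℚ suc n = a ℚ.* (a ^ℚ n)

module _ (N : ℕ) (H : FinAbGroup) where
  open FinAbGroup H

  allFuns : List (Fin N → Carrier)
  allFuns = List.map Vec.lookup (allVecs elements N)

  IsHom : (Fin N → Carrier) → Set
  IsHom φ = ∀ a b → φ (a +ₘ b) ≡ φ a ∙ φ b

  isHom? : (φ : Fin N → Carrier) → Dec (Data.List.Relation.Unary.All.All
             (λ a → Data.List.Relation.Unary.All.All (λ b → φ (a +ₘ b) ≡ φ a ∙ φ b) (allFin N)) (allFin N))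
  isHom? φ = all? (λ a → all? (λ b → φ (a +ₘ b) ≟ (φ a ∙ φ b)) (allFin N)) (allFin N)

  -- Hom(Z_N, H), each homomorphism listed exactly once
  homs : List (Fin N → Carrier)
  homs = filter isHom? allFuns

  Γ : ∀ {k} → Vec (Fin N) k → (Fin N → Carrier) → Vec Carrier k
  Γ x φ = Vec.map φ x

  inImage? : ∀ {k} (x : Vec (Fin N) k) (y : Vec Carrier k) → Dec _
  inImage? x y = any? (λ φ → VecP.≡-dec _≟_ (Γ x φ) y) homs

  kerSize : ∀ {k} → Vec (Fin N) k → ℕ
  kerSize {k} x = count (λ φ → VecP.≡-dec _≟_ (Γ x φ) (Vec.replicate k ε)) homs

  inG? : ∀ {k} (x : Vec (Fin N) k) → Dec _
  inG? {k} x = any? (λ y → ¬? (inImage? x y)) (allVecs elements k)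

  𝒢 : (k : ℕ) → List (Vec (Fin N) k)
  𝒢 k = filter inG? (allVecs (allFin N) k)

  passProb : (k : ℕ) → (Fin N → Carrier) → ℚ
  passProb k f =
    sum (List.map kerSize (filter (λ x → inImage? x (Vec.map f x)) (𝒢 k)))
      ÷ℕ sum (List.map kerSize (𝒢 k))

  agr : (Fin N → Carrier) → (Fin N → Carrier) → ℚ
  agr f φ = count (λ a → f a ≟ φ a) (allFin N) ÷ℕ N

{-# OPTIONS --safe #-}

-- Write N = pʳ and c(f,φ) = N · agr(f,φ).  The fiber of Γₓ over f(x) is empty or a coset of
-- ker Γₓ, so counting pairs (x,φ) with Γₓ(φ) = f(x) in two ways gives
--   δₖ = Σ_φ c(f,φ)ᵏ / Σ_φ c(1,φ)ᵏ   and   Σ_φ c(f,φ)ᵐ ≤ Kₘ := Σ_φ c(1,φ)ᵐ for every m.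
-- Here c(1,φ) = |ker φ| = N / ord φ, and at most pʲᵗ homomorphisms have order dividing pʲ, so a
-- geometric series bounds Kₘ by Nᵐ q / (q − 1) with q = pᵐ⁻ᵗ.  The upper bound is c(f,φ)ᵏ ≤ δₖ Kₖ.
-- For the lower one, let c be the largest c(f,φ); then
--   δₖ Nᵏ ≤ δₖ Kₖ ≤ cᵏ⁻ᵗ⁻¹ Kₜ₊₁ ≤ cᵏ⁻ᵗ⁻¹ Nᵗ⁺¹ p / (p − 1).
module Submission where

open import Defs
open import Algebra.Bundles using (AbelianGroup; Monoid)
open import Algebra.Structures using (IsAbelianGroup)
open import Data.Bool using (if_then_else_; true; false)
open import Data.Fin using (Fin; zero; suc; toℕ; fromℕ<; combine)
open import Data.Fin.Properties using (injective⇒≤; toℕ-injective; toℕ-fromℕ<; toℕ<n; fromℕ<-injective; combine-injective)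
import Data.Integer as ℤ
import Data.Integer.Properties as ℤ
open import Data.List as List using (List; []; _∷_; _++_; length; filter; concatMap; lookup; allFin; downFrom)
open import Data.List.Extrema.Nat using (argmax; argmax-all; f[xs]≤f[argmax])
open import Data.List.Membership.Propositional using (_∈_; find; lose)
open import Data.List.Membership.Propositional.Properties
import Data.List.Properties as List
open import Data.List.Relation.Unary.All as All using (All; []; _∷_)
import Data.List.Relation.Unary.All.Properties as All
open import Data.List.Relation.Unary.AllPairs as AllPairs using ([]; _∷_)
import Data.List.Relation.Unary.AllPairs.Properties as AllPairs
open import Data.List.Relation.Unary.Any as Any using (Any; here; there; index)
import Data.List.Relation.Unary.Any.Properties as Any
open import Data.List.Relation.Unary.Unique.Propositional using (Unique)
import Data.List.Relation.Unary.Unique.Propositional.Properties as Unique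
open import Data.Nat as ℕ using (ℕ; zero; suc; _^_; _+_; _∸_; _≥_; z≤n; s≤s; NonZero)
open import Data.Nat.Coprimality as Coprime using (Coprime; coprime-divisor; coprime-Bézout)
open import Data.Nat.DivMod
open import Data.Nat.Divisibility
open import Data.Nat.GCD using (module Bézout)
open import Data.Nat.ListAction using (sum)
open import Data.Nat.ListAction.Properties using (sum-++)
open import Data.Nat.Primality using (Prime; prime⇒irreducible; prime⇒nonZero; prime⇒nonTrivial)
import Data.Nat.Properties as ℕ
open import Data.Nat.Tactic.RingSolver using (solve-∀)
open import Data.Product using (Σ; ∃; ∃₂; _×_; _,_; proj₁; proj₂)
open import Data.Rational as ℚ using (toℚᵘ; fromℚᵘ)
import Data.Rational.Properties as ℚ
open import Data.Rational.Unnormalised as ℚᵘ using (mkℚᵘ; *≤*)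
import Data.Rational.Unnormalised.Properties as ℚᵘ
open import Data.Sum using (inj₁; inj₂)
open import Data.Vec as Vec using (Vec; []; _∷_)
import Data.Vec.Properties as Vec
open import Function using (_∘_; const)
open import Level using (0ℓ)
open import Relation.Binary.Definitions using (DecidableEquality)
open import Relation.Binary.PropositionalEquality
open import Relation.Nullary using (Dec; yes; no; does; ¬_; contradiction)
open import Relation.Nullary.Decidable using (_×-dec_)

-- The weight |ker Γₓ| in the test is exactly what the count needs: times the indicator of passing,
-- it is the number of homomorphisms through the values of `f` on `x`. The formula for δₖ also
-- requires sampling from all of Gᵏ rather than from a proper subset; this rests on G being cyclic,
-- so that a homomorphism is fixed by one value, and on t ≥ 1, which makes H nontrivial. The
-- geometric series for Kₘ has ratio pᵗ⁻ᵐ, so m = t + 1 is the first exponent at which it yields a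
-- bound independent of r. Hence the splitting k = (k - t - 1) + (t + 1): the first part is spent on
-- the maximal agreement, the second on the moment bound. No roots are taken: both inequalities are
-- stated between powers and, after cross-multiplication, become inequalities of natural numbers.

-- Finite sums, indicator functions and counting by injections.

module Counting where
  open import Data.Nat using (_*_; _≤_)

  private variable
    A B : Set
    P Q : A → Set

  ∑ : List A → (A → ℕ) → ℕ
  ∑ xs g = sum (List.map g xs)

  𝟙 : {P : Set} → Dec P → ℕ
  𝟙 d = if does d then 1 else 0

  𝟙-cong : {P Q : Set} → (P → Q) → (Q → P) → (d : Dec P) (e : Dec Q) → 𝟙 d ≡ 𝟙 e
  𝟙-cong to from (yes p) (yes q) = refl
  𝟙-cong to from (yes p) (no ¬q) = contradiction (to p) ¬q
  𝟙-cong to from (no ¬p) (yes q) = contradiction (from q) ¬p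
  𝟙-cong to from (no ¬p) (no ¬q) = refl

  𝟙-× : {P Q : Set} (d : Dec P) (e : Dec Q) → 𝟙 (d ×-dec e) ≡ 𝟙 d * 𝟙 e
  𝟙-× (yes p) e = sym (ℕ.+-identityʳ (𝟙 e))
  𝟙-× (no ¬p) e = refl

  ∑-cong : (xs : List A) {g h : A → ℕ} → (∀ {x} → x ∈ xs → g x ≡ h x) → ∑ xs g ≡ ∑ xs h
  ∑-cong xs eq = cong sum (List.map-cong-local {xs = xs} (All.tabulate eq))

  ∑-mono : (xs : List A) {g h : A → ℕ} → (∀ {x} → x ∈ xs → g x ≤ h x) → ∑ xs g ≤ ∑ xs h
  ∑-mono []       le = z≤n
  ∑-mono (x ∷ xs) le = ℕ.+-mono-≤ (le (here refl)) (∑-mono xs (le ∘ there))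

  ∑-member : (xs : List A) (g : A → ℕ) {x : A} → x ∈ xs → g x ≤ ∑ xs g
  ∑-member (x ∷ xs) g (here refl)  = ℕ.m≤m+n (g x) _
  ∑-member (y ∷ xs) g (there x∈xs) = ℕ.≤-trans (∑-member xs g x∈xs) (ℕ.m≤n+m _ (g y))

  ∑-0 : (xs : List A) → ∑ xs (λ _ → 0) ≡ 0
  ∑-0 []       = refl
  ∑-0 (_ ∷ xs) = ∑-0 xs

  ∑-1 : (xs : List A) → ∑ xs (λ _ → 1) ≡ length xs
  ∑-1 []       = refl
  ∑-1 (_ ∷ xs) = cong suc (∑-1 xs)

  ∑-distrib-+ : (xs : List A) (g h : A → ℕ) → ∑ xs (λ x → g x + h x) ≡ ∑ xs g + ∑ xs h
  ∑-distrib-+ []       g h = refl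
  ∑-distrib-+ (x ∷ xs) g h rewrite ∑-distrib-+ xs g h = interchange (g x) (h x) (∑ xs g) (∑ xs h)
    where open import Algebra.Properties.CommutativeSemigroup ℕ.+-commutativeSemigroup using (interchange)

  ∑-distribˡ-* : (xs : List A) (c : ℕ) (g : A → ℕ) → ∑ xs (λ x → c * g x) ≡ c * ∑ xs g
  ∑-distribˡ-* []       c g = sym (ℕ.*-zeroʳ c)
  ∑-distribˡ-* (x ∷ xs) c g rewrite ∑-distribˡ-* xs c g = sym (ℕ.*-distribˡ-+ c (g x) (∑ xs g))

  ∑-swap : (xs : List A) (ys : List B) (g : A → B → ℕ) →
           ∑ xs (λ x → ∑ ys (g x)) ≡ ∑ ys (λ y → ∑ xs (λ x → g x y))
  ∑-swap []       ys g = sym (∑-0 ys)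
  ∑-swap (x ∷ xs) ys g =
    trans (cong (∑ ys (g x) +_) (∑-swap xs ys g)) (sym (∑-distrib-+ ys (g x) _))

  ∑-map : (g : A → B) (xs : List A) (w : B → ℕ) → ∑ (List.map g xs) w ≡ ∑ xs (w ∘ g)
  ∑-map g xs w = cong sum (sym (List.map-∘ xs))

  ∑-concatMap : (g : A → List B) (xs : List A) (w : B → ℕ) →
                ∑ (concatMap g xs) w ≡ ∑ xs (λ x → ∑ (g x) w)
  ∑-concatMap g []       w = refl
  ∑-concatMap g (x ∷ xs) w = begin
    sum (List.map w (g x ++ concatMap g xs))  ≡⟨ cong sum (List.map-++ w (g x) _) ⟩
    sum (List.map w (g x) ++ List.map w (concatMap g xs))  ≡⟨ sum-++ (List.map w (g x)) _ ⟩
    ∑ (g x) w + ∑ (concatMap g xs) w          ≡⟨ cong (∑ (g x) w +_) (∑-concatMap g xs w) ⟩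
    ∑ (g x) w + ∑ xs (λ x → ∑ (g x) w)        ∎
    where open ≡-Reasoning

  ∑-filter : (P? : ∀ a → Dec (P a)) (xs : List A) (w : A → ℕ) →
             ∑ (filter P? xs) w ≡ ∑ xs (λ x → 𝟙 (P? x) * w x)
  ∑-filter P? []       w = refl
  ∑-filter P? (x ∷ xs) w with does (P? x)
  ... | true  = cong₂ _+_ (sym (ℕ.+-identityʳ (w x))) (∑-filter P? xs w)
  ... | false = ∑-filter P? xs w

  count-∑ : (P? : ∀ a → Dec (P a)) (xs : List A) → count P? xs ≡ ∑ xs (𝟙 ∘ P?)
  count-∑ P? []       = refl
  count-∑ P? (x ∷ xs) with does (P? x)
  ... | true  = cong suc (count-∑ P? xs)
  ... | false = count-∑ P? xs

  lookup-injective : {xs : List A} → Unique xs → ∀ i j → lookup xs i ≡ lookup xs j → i ≡ j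
  lookup-injective (_ ∷ _)   zero    zero    eq = refl
  lookup-injective (x∉ ∷ _)  zero    (suc j) eq = contradiction eq (All.lookup x∉ (∈-lookup j))
  lookup-injective (x∉ ∷ _)  (suc i) zero    eq = contradiction (sym eq) (All.lookup x∉ (∈-lookup i))
  lookup-injective (_ ∷ xs!) (suc i) (suc j) eq = cong suc (lookup-injective xs! i j eq)

  -- Pigeonhole on positions: a position in `xs` goes to a position of its image in `ys`, and
  -- `Unique xs` makes positions as good as elements. Injectivity is only asked on members of `xs`,
  -- which lets torsion or kernel conditions enter through membership.
  length-injective : {xs : List A} {ys : List B} (g : A → B) → Unique xs →
                     (∀ {x} → x ∈ xs → g x ∈ ys) →
                     (∀ {x y} → x ∈ xs → y ∈ xs → g x ≡ g y → x ≡ y) →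
                     length xs ≤ length ys
  length-injective {xs = xs} {ys} g xs! into inj = injective⇒≤ {f = pos} pos-injective
    where
    pos : Fin (length xs) → Fin (length ys)
    pos i = index (into (∈-lookup i))

    lookup-pos : ∀ i → g (lookup xs i) ≡ lookup ys (pos i)
    lookup-pos i = Any.lookup-index (into (∈-lookup i))

    pos-injective : ∀ {i j} → pos i ≡ pos j → i ≡ j
    pos-injective {i} {j} eq = lookup-injective xs! i j
      (inj (∈-lookup i) (∈-lookup j)
        (trans (lookup-pos i) (trans (cong (lookup ys) eq) (sym (lookup-pos j)))))

  count-injective : {xs : List A} {ys : List B} (P? : ∀ a → Dec (P a)) (Q? : ∀ b → Dec (Q b))
                    (g : A → B) → Unique xs →
                    (∀ {x} → x ∈ xs → P x → g x ∈ ys × Q (g x)) →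
                    (∀ {x y} → x ∈ xs → y ∈ xs → P x → P y → g x ≡ g y → x ≡ y) →
                    count P? xs ≤ count Q? ys
  count-injective P? Q? g xs! into inj = length-injective g (Unique.filter⁺ P? xs!)
    (λ x∈ → let x∈xs , px = ∈-filter⁻ P? x∈
                gx∈ys , qgx = into x∈xs px
            in ∈-filter⁺ Q? gx∈ys qgx)
    (λ x∈ y∈ → let x∈xs , px = ∈-filter⁻ P? x∈
                   y∈xs , py = ∈-filter⁻ P? y∈
               in inj x∈xs y∈xs px py)

  ∈-allVecs : {xs : List A} → (∀ x → x ∈ xs) → ∀ {k} (v : Vec A k) → v ∈ allVecs xs k
  ∈-allVecs all []      = here refl
  ∈-allVecs all (x ∷ v) =
    ∈-concatMap⁺ _ (Any.map (λ { refl → ∈-map⁺ (x ∷_) (∈-allVecs all v) }) (all x))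

  allVecs-unique : {xs : List A} → Unique xs → ∀ k → Unique (allVecs xs k)
  allVecs-unique xs! zero    = [] ∷ []
  allVecs-unique xs! (suc k) = Unique.concat⁺
    (All.map⁺ (All.tabulate λ _ → Unique.map⁺ Vec.∷-injectiveʳ (allVecs-unique xs! k)))
    (AllPairs.map⁺ (AllPairs.map
      (λ x≢y {_} (v∈x , v∈y) →
        let _ , _ , v≡x∷ = ∈-map⁻ _ v∈x
            _ , _ , v≡y∷ = ∈-map⁻ _ v∈y
        in x≢y (Vec.∷-injectiveˡ (trans (sym v≡x∷) v≡y∷)))
      xs!))

  ∑-allVecs : (xs : List A) (k : ℕ) (w : Vec A (suc k) → ℕ) →
              ∑ (allVecs xs (suc k)) w ≡ ∑ xs (λ x → ∑ (allVecs xs k) (λ v → w (x ∷ v)))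
  ∑-allVecs xs k w = trans (∑-concatMap _ xs w)
    (∑-cong xs (λ {x} _ → ∑-map (x ∷_) (allVecs xs k) w))

  length-allVecs : (xs : List A) (k : ℕ) → length (allVecs xs k) ≡ length xs ^ k
  length-allVecs xs zero    = refl
  length-allVecs xs (suc k) = begin
    length (allVecs xs (suc k))                    ≡⟨ ∑-1 (allVecs xs (suc k)) ⟨
    ∑ (allVecs xs (suc k)) (λ _ → 1)               ≡⟨ ∑-allVecs xs k (λ _ → 1) ⟩
    ∑ xs (λ _ → ∑ (allVecs xs k) (λ _ → 1))
      ≡⟨ ∑-cong xs (λ _ → trans (∑-1 (allVecs xs k)) (trans (length-allVecs xs k) (sym (ℕ.*-identityʳ _)))) ⟩
    ∑ xs (λ _ → length xs ^ k * 1)                 ≡⟨ ∑-distribˡ-* xs (length xs ^ k) (λ _ → 1) ⟩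
    length xs ^ k * ∑ xs (λ _ → 1)                 ≡⟨ cong (length xs ^ k *_) (∑-1 xs) ⟩
    length xs ^ k * length xs                      ≡⟨ ℕ.*-comm (length xs ^ k) (length xs) ⟩
    length xs ^ suc k                              ∎
    where open ≡-Reasoning

  -- Agreement on a tuple is agreement in each coordinate, so its indicator is a product and the sum
  -- over tuples factors. This is where k independent samples become a k-th power.
  count-agreeing-tuples : (_≟_ : DecidableEquality B) (f φ : A → B) (xs : List A) (k : ℕ) →
    ∑ (allVecs xs k) (λ x → 𝟙 (Vec.≡-dec _≟_ (Vec.map φ x) (Vec.map f x)))
      ≡ count (λ a → f a ≟ φ a) xs ^ k
  count-agreeing-tuples _≟_ f φ xs zero    = refl
  count-agreeing-tuples _≟_ f φ xs (suc k) = begin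
    ∑ (allVecs xs (suc k)) agree                            ≡⟨ ∑-allVecs xs k agree ⟩
    ∑ xs (λ a → ∑ (allVecs xs k) (λ x → agree (a ∷ x)))
      ≡⟨ ∑-cong xs (λ {a} _ → ∑-cong (allVecs xs k) (λ {x} _ → agree-∷ a x)) ⟩
    ∑ xs (λ a → ∑ (allVecs xs k) (λ x → 𝟙 (f a ≟ φ a) * agree x))
      ≡⟨ ∑-cong xs (λ {a} _ → trans (∑-distribˡ-* (allVecs xs k) (𝟙 (f a ≟ φ a)) agree) (cong (𝟙 (f a ≟ φ a) *_) (count-agreeing-tuples _≟_ f φ xs k))) ⟩
    ∑ xs (λ a → 𝟙 (f a ≟ φ a) * c ^ k)
      ≡⟨ ∑-cong xs (λ {a} _ → ℕ.*-comm (𝟙 (f a ≟ φ a)) (c ^ k)) ⟩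
    ∑ xs (λ a → c ^ k * 𝟙 (f a ≟ φ a))                      ≡⟨ ∑-distribˡ-* xs (c ^ k) _ ⟩
    c ^ k * ∑ xs (λ a → 𝟙 (f a ≟ φ a))                      ≡⟨ cong (c ^ k *_) (count-∑ (λ a → f a ≟ φ a) xs) ⟨
    c ^ k * c                                               ≡⟨ ℕ.*-comm (c ^ k) c ⟩
    c ^ suc k                                               ∎
    where
    open ≡-Reasoning
    c = count (λ a → f a ≟ φ a) xs
    agree : ∀ {k} → Vec _ k → ℕ
    agree x = 𝟙 (Vec.≡-dec _≟_ (Vec.map φ x) (Vec.map f x))
    agree-∷ : ∀ {k} a (x : Vec _ k) → agree (a ∷ x) ≡ 𝟙 (f a ≟ φ a) * agree x
    agree-∷ a x = trans
      (𝟙-cong (λ eq → sym (Vec.∷-injectiveˡ eq) , Vec.∷-injectiveʳ eq)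
              (λ (eq , eqs) → cong₂ _∷_ (sym eq) eqs)
              (Vec.≡-dec _≟_ (Vec.map φ (a ∷ x)) (Vec.map f (a ∷ x)))
              ((f a ≟ φ a) ×-dec Vec.≡-dec _≟_ (Vec.map φ x) (Vec.map f x)))
      (𝟙-× (f a ≟ φ a) (Vec.≡-dec _≟_ (Vec.map φ x) (Vec.map f x)))

open Counting

-- Reduction of rational identities and inequalities to natural numbers.

module Fractions where
  open import Data.Integer using (+_; +≤+)
  open import Data.Nat using (_*_; _≤_)

  -- Rationals are stored in lowest terms, which hides numerators and denominators; the product is
  -- therefore computed on unnormalised fractions, where it is componentwise.
  ÷ℕ-*-÷ℕ : ∀ a b c d .{{_ : NonZero b}} .{{_ : NonZero d}} →
            (a ÷ℕ b) ℚ.* (c ÷ℕ d) ≡ (a * c) ÷ℕ (b * d)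
  ÷ℕ-*-÷ℕ a (suc b) c (suc d) = ℚ.toℚᵘ-injective (begin
    toℚᵘ (fromℚᵘ x ℚ.* fromℚᵘ y)            ≈⟨ ℚ.toℚᵘ-homo-* (fromℚᵘ x) (fromℚᵘ y) ⟩
    toℚᵘ (fromℚᵘ x) ℚᵘ.* toℚᵘ (fromℚᵘ y)    ≈⟨ ℚᵘ.*-cong (ℚ.toℚᵘ-fromℚᵘ x) (ℚ.toℚᵘ-fromℚᵘ y) ⟩
    x ℚᵘ.* y                                ≡⟨ cong (λ n → mkℚᵘ n _) (ℤ.pos-* a c) ⟨
    mkℚᵘ (+ (a * c)) (d + b * suc d)        ≈⟨ ℚ.toℚᵘ-fromℚᵘ _ ⟨
    toℚᵘ ((a * c) ÷ℕ (suc b * suc d))       ∎)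
    where
    open import Relation.Binary.Reasoning.Setoid ℚᵘ.≃-setoid
    x = mkℚᵘ (+ a) b
    y = mkℚᵘ (+ c) d

  ÷ℕ-^ : ∀ a b m .{{_ : NonZero b}} → (a ÷ℕ b) ^ℚ m ≡ (a ^ m) ÷ℕ (b ^ m)
  ÷ℕ-^ a b zero    = refl
  ÷ℕ-^ a b (suc m) = trans (cong ((a ÷ℕ b) ℚ.*_) (÷ℕ-^ a b m))
    (÷ℕ-*-÷ℕ a b (a ^ m) (b ^ m))
    where instance _ = ℕ.m^n≢0 b m

  ÷ℕ-mono-≤ : ∀ a b c d .{{_ : NonZero b}} .{{_ : NonZero d}} → a * d ≤ c * b → a ÷ℕ b ℚ.≤ c ÷ℕ d
  ÷ℕ-mono-≤ a (suc b) c (suc d) ad≤cb = ℚ.toℚᵘ-cancel-≤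
    (ℚᵘ.≤-respˡ-≃ (ℚᵘ.≃-sym (ℚ.toℚᵘ-fromℚᵘ (mkℚᵘ (+ a) b)))
      (ℚᵘ.≤-respʳ-≃ (ℚᵘ.≃-sym (ℚ.toℚᵘ-fromℚᵘ (mkℚᵘ (+ c) d)))
        (*≤* (subst₂ ℤ._≤_ (ℤ.pos-* a (suc d)) (ℤ.pos-* c (suc b)) (+≤+ ad≤cb)))))

open Fractions

-- Coprimality of prime powers and the geometric series.

module Arithmetic where
  open import Data.Nat using (_*_; _≤_)

  coprime-^ˡ : ∀ {m n} e → Coprime m n → Coprime (m ^ e) n
  coprime-^ˡ zero    c (d∣1 , _)     = ∣1⇒≡1 d∣1
  coprime-^ˡ (suc e) c (d∣mᵉ⁺¹ , d∣n) = coprime-^ˡ e c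
    (coprime-divisor (λ (x∣d , x∣m) → c (x∣m , ∣-trans x∣d d∣n)) d∣mᵉ⁺¹ , d∣n)

  prime∤⇒coprime : ∀ {p n} → Prime p → ¬ p ∣ n → Coprime p n
  prime∤⇒coprime pr p∤n (d∣p , d∣n) with prime⇒irreducible pr d∣p
  ... | inj₁ d≡1  = d≡1
  ... | inj₂ refl = contradiction d∣n p∤n

  distinct-primes⇒coprime : ∀ {p ℓ} → Prime p → Prime ℓ → ℓ ≢ p → Coprime p ℓ
  distinct-primes⇒coprime {p} pr ℓ-pr ℓ≢p = prime∤⇒coprime pr p∤ℓ
    where
    p∤ℓ : ¬ p ∣ _
    p∤ℓ p∣ℓ with prime⇒irreducible ℓ-pr p∣ℓ
    ... | inj₁ refl = contradiction refl (ℕ.nonTrivial⇒≢1 {{prime⇒nonTrivial pr}})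
    ... | inj₂ refl = ℓ≢p refl

  -- With S(r) the sum, S(r+1) = p^((r+1)m) + pᵗ S(r); induction turns pᵗ (q - 1) S(r) into at most
  -- q pᵗ p^(rm) ≤ p^((r+1)m), which fills the missing unit of q. Asking only for q pᵗ ≤ pᵐ allows q
  -- to be fixed while m varies.
  geometric-sum-bound : ∀ p m t q .{{_ : NonZero q}} → q * p ^ t ≤ p ^ m → ∀ r →
    (q ∸ 1) * ∑ (downFrom (suc r)) (λ i → (p ^ i) ^ m * (p ^ (r ∸ i)) ^ t) ≤ q * (p ^ r) ^ m
  geometric-sum-bound p m t (suc q) le zero = begin
    q * (1 ^ m * 1 ^ t + 0)
      ≡⟨ cong (q *_) (trans (ℕ.+-identityʳ _) (trans (cong (1 ^ m *_) (ℕ.^-zeroˡ t)) (ℕ.*-identityʳ _))) ⟩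
    q * 1 ^ m               ≤⟨ ℕ.*-monoˡ-≤ (1 ^ m) (ℕ.n≤1+n q) ⟩
    suc q * 1 ^ m           ∎
    where open ℕ.≤-Reasoning
  geometric-sum-bound p m t (suc q) le (suc r) = begin
    q * (P * (p ^ (r ∸ r)) ^ t + ∑ js (λ i → (p ^ i) ^ m * (p ^ (suc r ∸ i)) ^ t))
      ≡⟨ cong (λ s → q * (s + ∑ js (λ i → (p ^ i) ^ m * (p ^ (suc r ∸ i)) ^ t))) first ⟩
    q * (P + ∑ js (λ i → (p ^ i) ^ m * (p ^ (suc r ∸ i)) ^ t))
      ≡⟨ cong (λ s → q * (P + s)) (trans (∑-cong js rest) (∑-distribˡ-* js (p ^ t) _)) ⟩
    q * (P + p ^ t * S)          ≡⟨ regroup q P (p ^ t) S ⟩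
    q * P + p ^ t * (q * S)
      ≤⟨ ℕ.+-monoʳ-≤ (q * P) (ℕ.*-monoʳ-≤ (p ^ t) (geometric-sum-bound p m t (suc q) le r)) ⟩
    q * P + p ^ t * (suc q * (p ^ r) ^ m) ≡⟨ cong (q * P ℕ.+_) (regroup′ (p ^ t) (suc q) ((p ^ r) ^ m)) ⟩
    q * P + suc q * p ^ t * (p ^ r) ^ m   ≤⟨ ℕ.+-monoʳ-≤ (q * P) (ℕ.*-monoˡ-≤ ((p ^ r) ^ m) le) ⟩
    q * P + p ^ m * (p ^ r) ^ m  ≡⟨ cong (q * P ℕ.+_) (sym (^-distribʳ-* p (p ^ r) m)) ⟩
    q * P + P                    ≡⟨ ℕ.+-comm (q * P) P ⟩
    suc q * P                    ∎
    where
    open ℕ.≤-Reasoning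
    js = downFrom (suc r)
    P = (p ^ suc r) ^ m
    S = ∑ js (λ i → (p ^ i) ^ m * (p ^ (r ∸ i)) ^ t)
    ^-distribʳ-* : ∀ a b n → (a * b) ^ n ≡ a ^ n * b ^ n
    ^-distribʳ-* a b zero    = refl
    ^-distribʳ-* a b (suc n) rewrite ^-distribʳ-* a b n = lemma a b (a ^ n) (b ^ n)
      where
      lemma : ∀ a b c d → a * b * (c * d) ≡ a * c * (b * d)
      lemma = solve-∀
    first : P * (p ^ (r ∸ r)) ^ t ≡ P
    first rewrite ℕ.n∸n≡0 r | ℕ.^-zeroˡ t = ℕ.*-identityʳ P
    rest : ∀ {i} → i ∈ js → (p ^ i) ^ m * (p ^ (suc r ∸ i)) ^ t ≡ p ^ t * ((p ^ i) ^ m * (p ^ (r ∸ i)) ^ t)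
    rest {i} i∈ rewrite ℕ.+-∸-assoc 1 (ℕ.≤-pred (∈-downFrom⁻ i∈)) | ^-distribʳ-* p (p ^ (r ∸ i)) t =
      swap ((p ^ i) ^ m) (p ^ t) ((p ^ (r ∸ i)) ^ t)
      where
      swap : ∀ a b c → a * (b * c) ≡ b * (a * c)
      swap = solve-∀
    regroup : ∀ q a b s → q * (a + b * s) ≡ q * a + b * (q * s)
    regroup = solve-∀
    regroup′ : ∀ a b c → a * (b * c) ≡ b * a * c
    regroup′ = solve-∀

open Arithmetic

-- Torsion in a product of cyclic groups.

module ProductTorsion where
  open import Data.Nat using (_*_; _<_)

  -- Adding u to v repeatedly: M u = 0 is expressed as addₘ M u v ≡ v, so that Fin q needs no zero.
  addₘ : ∀ {q} → ℕ → Fin q → Fin q → Fin q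
  addₘ zero    a b = b
  addₘ (suc M) a b = a +ₘ addₘ M a b

  addᴾ : ∀ qs → ℕ → Prod qs → Prod qs → Prod qs
  addᴾ qs zero    u v = v
  addᴾ qs (suc M) u v = _+ᴾ_ {qs} u (addᴾ qs M u v)

  addᴾ-∷ : ∀ q qs M (a b : Fin q) (u v : Prod qs) →
           addᴾ (q ∷ qs) M (a , u) (b , v) ≡ (addₘ M a b , addᴾ qs M u v)
  addᴾ-∷ q qs zero    a b u v = refl
  addᴾ-∷ q qs (suc M) a b u v rewrite addᴾ-∷ q qs M a b u v = refl

  toℕ-+ₘ : ∀ {n} (a b : Fin (suc n)) → toℕ (a +ₘ b) ≡ (toℕ a + toℕ b) % suc n
  toℕ-+ₘ a b = toℕ-fromℕ< _

  toℕ-addₘ : ∀ {n} M (a b : Fin (suc n)) → toℕ (addₘ M a b) ≡ (M * toℕ a + toℕ b) % suc n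
  toℕ-addₘ     zero    a b = sym (m<n⇒m%n≡m (toℕ<n b))
  toℕ-addₘ {n} (suc M) a b = begin
    toℕ (a +ₘ addₘ M a b)                               ≡⟨ toℕ-+ₘ a (addₘ M a b) ⟩
    (toℕ a + toℕ (addₘ M a b)) % suc n
      ≡⟨ %-congˡ (cong₂ _+_ (sym (m<n⇒m%n≡m (toℕ<n a))) (toℕ-addₘ M a b)) ⟩
    (toℕ a % suc n + (M * toℕ a + toℕ b) % suc n) % suc n ≡⟨ %-distribˡ-+ (toℕ a) _ (suc n) ⟨
    (toℕ a + (M * toℕ a + toℕ b)) % suc n               ≡⟨ %-congˡ (ℕ.+-assoc (toℕ a) _ _) ⟨
    (suc M * toℕ a + toℕ b) % suc n                     ∎
    where open ≡-Reasoning

  addₘ-fixed⇒∣ : ∀ {q} M (a b : Fin q) → addₘ M a b ≡ b → q ∣ M * toℕ a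
  addₘ-fixed⇒∣ {suc n} M a b eq = divides (x / suc n) (ℕ.+-cancelʳ-≡ (toℕ b) _ _ (begin
    x                               ≡⟨ m≡m%n+[m/n]*n x (suc n) ⟩
    x % suc n + x / suc n * suc n   ≡⟨ cong (_+ x / suc n * suc n) (trans (sym (toℕ-addₘ M a b)) (cong toℕ eq)) ⟩
    toℕ b + x / suc n * suc n       ≡⟨ ℕ.+-comm (toℕ b) _ ⟩
    x / suc n * suc n + toℕ b       ∎))
    where
    open ≡-Reasoning
    x = M * toℕ a + toℕ b

  -- An M-torsion element a of ℤ/q is determined by M a / q < M.
  encodeₘ : ∀ {q} M .{{_ : NonZero M}} → Fin q → Fin M
  encodeₘ {suc n} M a = fromℕ< (m<n*o⇒m/o<n {n = M} {suc n} (ℕ.*-monoʳ-< M (toℕ<n a)))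

  -- Both divisions by q are exact, so equal quotients give M a = M b, and M cancels.
  encodeₘ-injective : ∀ {q} M .{{_ : NonZero M}} (a b : Fin q) →
    q ∣ M * toℕ a → q ∣ M * toℕ b → encodeₘ M a ≡ encodeₘ M b → a ≡ b
  encodeₘ-injective {suc n} M a b q∣Ma q∣Mb eq =
    toℕ-injective (ℕ.*-cancelˡ-≡ _ _ M (/-cancelʳ-≡ q∣Ma q∣Mb (fromℕ<-injective _ _ _ _ eq)))

  -- One digit in base M for each summand of p-power order. The remaining coordinates are dropped
  -- because p-power torsion vanishes there.
  encodeᴾ : ∀ {p qs t} M .{{_ : NonZero M}} → PRank p qs t → Prod qs → Fin (M ^ t)
  encodeᴾ M []       _       = zero
  encodeᴾ M (_ ∷ᵖ R) (a , u) = combine (encodeₘ M a) (encodeᴾ M R u)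
  encodeᴾ M (_ ∷ⁿ R) (_ , u) = encodeᴾ M R u

  coprime-∣-Fin⇒≡0 : ∀ {q} M (a : Fin q) → Coprime q M → q ∣ M * toℕ a → toℕ a ≡ 0
  coprime-∣-Fin⇒≡0 {suc n} M a c q∣Ma = trans (sym (m<n⇒m%n≡m (toℕ<n a)))
    (n∣m⇒m%n≡0 (toℕ a) (suc n) (coprime-divisor c q∣Ma))

  -- In a summand of p-power order the digit determines the coordinate. In any other the order is ℓᵉ
  -- with ℓ ≠ p, hence coprime to pʲ, so both torsion coordinates are 0. This yields |H[pʲ]| ≤ pʲᵗ.
  encodeᴾ-injective : ∀ {p qs t} → Prime p → All IsPrimePower qs → ∀ j .{{_ : NonZero (p ^ j)}} →
    (R : PRank p qs t) (u v : Prod qs) →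
    addᴾ qs (p ^ j) u u ≡ u → addᴾ qs (p ^ j) v v ≡ v →
    encodeᴾ (p ^ j) R u ≡ encodeᴾ (p ^ j) R v → u ≡ v
  encodeᴾ-injective pr [] j [] u v _ _ _ = refl
  encodeᴾ-injective {p} {q ∷ qs} pr (_ ∷ pps) j (_ ∷ᵖ R) (a , u) (b , v) tu tv eq =
    cong₂ _,_
      (encodeₘ-injective (p ^ j) a b (addₘ-fixed⇒∣ (p ^ j) a a (cong proj₁ tu′))
        (addₘ-fixed⇒∣ (p ^ j) b b (cong proj₁ tv′)) (proj₁ eqs))
      (encodeᴾ-injective pr pps j R u v (cong proj₂ tu′) (cong proj₂ tv′) (proj₂ eqs))
    where
    tu′ = trans (sym (addᴾ-∷ q qs (p ^ j) a a u u)) tu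
    tv′ = trans (sym (addᴾ-∷ q qs (p ^ j) b b v v)) tv
    eqs = combine-injective _ _ _ _ eq
  encodeᴾ-injective {p} {q ∷ qs} pr ((ℓ , e , ℓ-pr , e≥1 , refl) ∷ pps) j (¬pw ∷ⁿ R) (a , u) (b , v) tu tv eq =
    cong₂ _,_
      (toℕ-injective (trans (vanish a (cong proj₁ tu′)) (sym (vanish b (cong proj₁ tv′)))))
      (encodeᴾ-injective pr pps j R u v (cong proj₂ tu′) (cong proj₂ tv′) eq)
    where
    tu′ = trans (sym (addᴾ-∷ q qs (p ^ j) a a u u)) tu
    tv′ = trans (sym (addᴾ-∷ q qs (p ^ j) b b v v)) tv
    ℓ≢p : ℓ ≢ p
    ℓ≢p refl = ¬pw (e , e≥1 , refl)
    vanish : (c : Fin q) → addₘ (p ^ j) c c ≡ c → toℕ c ≡ 0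
    vanish c tc = coprime-∣-Fin⇒≡0 (p ^ j) c
      (coprime-^ˡ e (Coprime.sym (coprime-^ˡ j (distinct-primes⇒coprime pr ℓ-pr ℓ≢p))))
      (addₘ-fixed⇒∣ (p ^ j) c c tc)

  other : ∀ {q} → 1 < q → (a : Fin q) → ∃ λ b → a ≢ b
  other {suc (suc q)} _ zero    = suc zero , λ ()
  other {suc (suc q)} _ (suc a) = zero , λ ()
  other {suc zero} (s≤s ())

  -- A summand of order pᵉ with e ≥ 1 has at least two elements; the given tuple supplies all the
  -- other coordinates.
  Prod-nontrivial : ∀ {p qs t} → Prime p → PRank p qs t → t ≥ 1 → Prod qs → ∃₂ λ (u v : Prod qs) → u ≢ v
  Prod-nontrivial {p} pr ((e , e≥1 , refl) ∷ᵖ R) t≥1 (a , u) =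
    let b , a≢b = other (ℕ.≤-trans (ℕ.nonTrivial⇒n>1 p {{prime⇒nonTrivial pr}})
                          (ℕ.≤-trans (ℕ.≤-reflexive (sym (ℕ.^-identityʳ p)))
                            (ℕ.^-monoʳ-≤ p {{prime⇒nonZero pr}} e≥1))) a
    in (a , u) , (b , u) , λ eq → a≢b (cong proj₁ eq)
  Prod-nontrivial pr (_ ∷ⁿ R) t≥1 (a , u) =
    let v , w , v≢w = Prod-nontrivial pr R t≥1 u
    in (a , v) , (a , w) , λ eq → v≢w (cong proj₂ eq)

open ProductTorsion

-- Orders of elements and torsion in H.

module FiniteAbelianGroup (H : FinAbGroup) where
  open import Data.Nat using (_*_; _≤_)
  open FinAbGroup H public
  open IsAbelianGroup isAbelianGroup public
    using (assoc; identityˡ; identityʳ; inverseʳ; isMonoid)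

  abelianGroup : AbelianGroup 0ℓ 0ℓ
  abelianGroup = record { isAbelianGroup = isAbelianGroup }

  open AbelianGroup abelianGroup public using (group; commutativeSemigroup)

  monoid : Monoid 0ℓ 0ℓ
  monoid = record { isMonoid = isMonoid }

  open import Algebra.Properties.Monoid.Mult monoid public
    using (×-assocˡ) renaming (_×_ to infixr 7 _·_)
  open import Algebra.Properties.Group group public
    using (∙-cancelʳ; identityˡ-unique)
  open import Algebra.Properties.AbelianGroup abelianGroup public using (⁻¹-∙-comm)
  open import Algebra.Properties.CommutativeSemigroup commutativeSemigroup public using (interchange)

  ·-zeroʳ : ∀ n → n · ε ≡ ε
  ·-zeroʳ zero    = refl
  ·-zeroʳ (suc n) = trans (identityˡ (n · ε)) (·-zeroʳ n)

  *-annihilates : ∀ m {n h} → n · h ≡ ε → (m * n) · h ≡ ε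
  *-annihilates m {n} {h} nh≡ε = trans (sym (×-assocˡ h m n)) (trans (cong (m ·_) nh≡ε) (·-zeroʳ m))

  -- Bézout over ℕ reads 1 + y n = x m or 1 + x m = y n; applied to `h`, both multiples vanish and
  -- `h` alone remains.
  coprime-annihilators : ∀ {m n h} → Coprime m n → m · h ≡ ε → n · h ≡ ε → h ≡ ε
  coprime-annihilators {m} {n} {h} c mh≡ε nh≡ε with coprime-Bézout c
  ... | Bézout.+- x y eq = trans (sym (identityʳ h)) (trans (cong (h ∙_) (sym (*-annihilates y {n} nh≡ε)))
                            (trans (cong (_· h) eq) (*-annihilates x {m} mh≡ε)))
  ... | Bézout.-+ x y eq = trans (sym (identityʳ h)) (trans (cong (h ∙_) (sym (*-annihilates x {m} mh≡ε)))
                            (trans (cong (_· h) eq) (*-annihilates y {n} nh≡ε)))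

  -- The order of `h` ≠ `ε` is p times the order of `p · h`, which gives the recursion. An
  -- annihilator a of such an `h` is divisible by p, since otherwise a and the given power of p
  -- would be coprime annihilators; a / p then annihilates `p · h`.
  prime-power-order : ∀ {p} → Prime p → ∀ r h → p ^ r · h ≡ ε →
    ∃ λ j → j ≤ r × p ^ j · h ≡ ε × (∀ a → a · h ≡ ε → p ^ j ∣ a)
  prime-power-order pr zero h eq = 0 , z≤n , eq , λ a _ → 1∣ a
  prime-power-order {p} pr (suc r) h eq with h ≟ ε
  ... | yes refl = 0 , z≤n , identityʳ ε , λ a _ → 1∣ a
  ... | no h≢ε with prime-power-order pr r (p · h) (trans (×-assocˡ h (p ^ r) p) (trans (cong (_· h) (ℕ.*-comm (p ^ r) p)) eq))
  ... | j , j≤r , pʲph≡ε , least = suc j , s≤s j≤r ,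
          trans (cong (_· h) (ℕ.*-comm p (p ^ j))) (trans (sym (×-assocˡ h (p ^ j) p)) pʲph≡ε) , divides-annihilator
    where
    divides-annihilator : ∀ a → a · h ≡ ε → p ^ suc j ∣ a
    divides-annihilator a ah≡ε with p ∣? a
    ... | no p∤a = contradiction (coprime-annihilators (coprime-^ˡ (suc r) (prime∤⇒coprime pr p∤a)) eq ah≡ε) h≢ε
    ... | yes (divides b refl) = subst (_∣ b * p) (ℕ.*-comm (p ^ j) p)
            (*-monoˡ-∣ p (least b (trans (×-assocˡ h b p) ah≡ε)))

  elements-complete : ∀ h → h ∈ elements
  elements-complete h = let i , eq = proj₂ enum-bij h in
    subst (_∈ elements) (eq refl) (∈-map⁺ enum (∈-allFin i))

  elements-unique : Unique elements
  elements-unique = Unique.map⁺ (proj₁ enum-bij) (Unique.allFin⁺ size)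

  module _ {qs : List ℕ} (D : PrimaryDecomposition H qs) where
    open PrimaryDecomposition D

    coordinates : Carrier → Prod qs
    coordinates h = proj₁ (proj₂ iso-bij h)

    iso-coordinates : ∀ h → iso (coordinates h) ≡ h
    iso-coordinates h = proj₂ (proj₂ iso-bij h) refl

    iso-addᴾ : ∀ M u v → iso (addᴾ qs M u v) ≡ (M · iso u) ∙ iso v
    iso-addᴾ zero    u v = sym (identityˡ (iso v))
    iso-addᴾ (suc M) u v = trans (iso-hom u (addᴾ qs M u v))
      (trans (cong (iso u ∙_) (iso-addᴾ M u v)) (sym (assoc (iso u) (M · iso u) (iso v))))

    -- Under `iso` the left side becomes M h + h, which is h for torsion h.
    torsion-coordinates : ∀ M h → M · h ≡ ε → addᴾ qs M (coordinates h) (coordinates h) ≡ coordinates h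
    torsion-coordinates M h Mh≡ε = proj₁ iso-bij (trans (iso-addᴾ M _ _)
      (trans (cong (_∙ iso (coordinates h)) (trans (cong (M ·_) (iso-coordinates h)) Mh≡ε)) (identityˡ _)))

    coordinates-injective : ∀ {g h} → coordinates g ≡ coordinates h → g ≡ h
    coordinates-injective {g} {h} eq = trans (sym (iso-coordinates g)) (trans (cong iso eq) (iso-coordinates h))

    size-nontrivial : ∀ {p t} → Prime p → PRank p qs t → t ≥ 1 → 2 ≤ length elements
    size-nontrivial pr R t≥1 with Prod-nontrivial pr R t≥1 (coordinates ε)
    ... | u , v , u≢v = length-injective {xs = u ∷ v ∷ []} iso
          ((u≢v ∷ []) ∷ [] ∷ []) (λ _ → elements-complete _) (λ _ _ → proj₁ iso-bij)

-- Homomorphisms from a cyclic group, their fibers and their kernels.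

module CyclicHom (n : ℕ) (H : FinAbGroup) where
  open import Data.Nat using (_*_; _≤_)
  open FiniteAbelianGroup H

  private
    N = suc n
    Hom = IsHom N H
    hs = homs N H

  -- `residue 1` is the generator for every N: when N = 1 it is `zero`, so the trivial group needs
  -- no separate case.
  residue : ℕ → Fin N
  residue m = fromℕ< (m%n<n m N)

  residue-toℕ : ∀ a → residue (toℕ a) ≡ a
  residue-toℕ a = toℕ-injective (trans (toℕ-fromℕ< _) (m<n⇒m%n≡m (toℕ<n a)))

  residue-suc : ∀ m → residue (suc m) ≡ residue 1 +ₘ residue m
  residue-suc m = toℕ-injective (begin
    toℕ (residue (suc m))                      ≡⟨ toℕ-fromℕ< _ ⟩
    (1 + m) % N                                ≡⟨ %-distribˡ-+ 1 m N ⟩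
    (1 % N + m % N) % N
      ≡⟨ %-congˡ (cong₂ _+_ (toℕ-fromℕ< (m%n<n 1 N)) (toℕ-fromℕ< (m%n<n m N))) ⟨
    (toℕ (residue 1) + toℕ (residue m)) % N    ≡⟨ toℕ-+ₘ (residue 1) (residue m) ⟨
    toℕ (residue 1 +ₘ residue m)               ∎)
    where open ≡-Reasoning

  module _ {φ : Fin N → Carrier} (φ-hom : Hom φ) where

    hom-zero : φ zero ≡ ε
    hom-zero = identityˡ-unique (φ zero) (φ zero) (sym (φ-hom zero zero))

    hom-residue : ∀ m → φ (residue m) ≡ m · φ (residue 1)
    hom-residue zero    = hom-zero
    hom-residue (suc m) = trans (cong φ (residue-suc m))
      (trans (φ-hom (residue 1) (residue m)) (cong (φ (residue 1) ∙_) (hom-residue m)))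

    hom-toℕ : ∀ a → φ a ≡ toℕ a · φ (residue 1)
    hom-toℕ a = trans (cong φ (sym (residue-toℕ a))) (hom-residue (toℕ a))

    hom-annihilated : N · φ (residue 1) ≡ ε
    hom-annihilated = trans (sym (hom-residue N))
      (trans (cong φ (toℕ-injective (trans (toℕ-fromℕ< _) (n%n≡0 N)))) hom-zero)

  hom-determined : ∀ {φ ψ} → Hom φ → Hom ψ → φ (residue 1) ≡ ψ (residue 1) → φ ≗ ψ
  hom-determined φ-hom ψ-hom eq a =
    trans (hom-toℕ φ-hom a) (trans (cong (toℕ a ·_) eq) (sym (hom-toℕ ψ-hom a)))

  hom-resp-≗ : ∀ {φ ψ} → φ ≗ ψ → Hom φ → Hom ψ
  hom-resp-≗ eq φ-hom a b = trans (sym (eq _)) (trans (φ-hom a b) (cong₂ _∙_ (eq a) (eq b)))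

  hom-ε : Hom (const ε)
  hom-ε a b = sym (identityˡ ε)

  hom-∙ : ∀ {φ ψ} → Hom φ → Hom ψ → Hom (λ a → φ a ∙ ψ a)
  hom-∙ {φ} {ψ} φ-hom ψ-hom a b =
    trans (cong₂ _∙_ (φ-hom a b) (ψ-hom a b)) (interchange (φ a) (φ b) (ψ a) (ψ b))

  hom-⁻¹ : ∀ {φ} → Hom φ → Hom (λ a → φ a ⁻¹)
  hom-⁻¹ {φ} φ-hom a b = trans (cong _⁻¹ (φ-hom a b)) (sym (⁻¹-∙-comm (φ a) (φ b)))

  -- homs lists functions of the form Vec.lookup v; without function extensionality a
  -- homomorphism is found in it only after this normalisation.
  canonical : (Fin N → Carrier) → Fin N → Carrier
  canonical φ = Vec.lookup (Vec.tabulate φ)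

  canonical-≗ : ∀ φ → canonical φ ≗ φ
  canonical-≗ = Vec.lookup∘tabulate

  homs-sound : ∀ {φ} → φ ∈ hs → Hom φ
  homs-sound φ∈ a b = All.lookup (All.lookup (proj₂ (∈-filter⁻ (isHom? N H) {xs = allFuns N H} φ∈)) (∈-allFin a)) (∈-allFin b)

  homs-complete : ∀ {φ} → Hom φ → canonical φ ∈ hs
  homs-complete {φ} φ-hom = ∈-filter⁺ (isHom? N H)
    (∈-map⁺ Vec.lookup (∈-allVecs elements-complete (Vec.tabulate φ)))
    (All.tabulate λ {a} _ → All.tabulate λ {b} _ → hom-resp-≗ (sym ∘ canonical-≗ φ) φ-hom a b)

  homs-canonical : ∀ {φ} → φ ∈ hs → canonical φ ≡ φ
  homs-canonical φ∈ with ∈-map⁻ Vec.lookup (proj₁ (∈-filter⁻ (isHom? N H) {xs = allFuns N H} φ∈))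
  ... | v , _ , refl = cong Vec.lookup (Vec.tabulate∘lookup v)

  homs-ext : ∀ {φ ψ} → φ ∈ hs → ψ ∈ hs → φ ≗ ψ → φ ≡ ψ
  homs-ext φ∈ ψ∈ eq = trans (sym (homs-canonical φ∈))
    (trans (cong Vec.lookup (Vec.tabulate-cong eq)) (homs-canonical ψ∈))

  homs-unique : Unique hs
  homs-unique = Unique.filter⁺ (isHom? N H)
    (Unique.map⁺ lookup-injectiveᵛ (allVecs-unique elements-unique N))
    where
    lookup-injectiveᵛ : ∀ {v w : Vec Carrier N} → Vec.lookup v ≡ Vec.lookup w → v ≡ w
    lookup-injectiveᵛ {v} {w} eq =
      trans (sym (Vec.tabulate∘lookup v)) (trans (cong Vec.tabulate eq) (Vec.tabulate∘lookup w))

  -- Evaluation at the generator embeds Hom in H.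
  length-homs : length hs ≤ length elements
  length-homs = length-injective (λ φ → φ (residue 1)) homs-unique (λ _ → elements-complete _)
    (λ φ∈ ψ∈ eq → homs-ext φ∈ ψ∈ (hom-determined (homs-sound φ∈) (homs-sound ψ∈) eq))

  -- `kerSize` is by definition the case where `y` is the tuple of `ε`s, so results on fibers apply
  -- to kernels directly.
  fiber : ∀ {k} → Vec (Fin N) k → Vec Carrier k → ℕ
  fiber x y = count (λ φ → Vec.≡-dec _≟_ (Γ N H x φ) y) hs

  -- Translation by a fixed homomorphism is injective, and it carries fibers of Γ to fibers.
  fiber-translate : ∀ {k} (x : Vec (Fin N) k) {y z : Vec Carrier k} {ψ} → Hom ψ →
    (∀ {φ} → Γ N H x φ ≡ y → Γ N H x (λ a → φ a ∙ ψ a) ≡ z) → fiber x y ≤ fiber x z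
  fiber-translate x {ψ = ψ} ψ-hom maps = count-injective _ _ translate homs-unique
    (λ {φ} φ∈ eq → homs-complete (hom-∙ (homs-sound φ∈) ψ-hom) ,
                   trans (Vec.map-cong (canonical-≗ _) x) (maps eq))
    (λ {φ} {φ′} φ∈ φ′∈ _ _ eq → homs-ext φ∈ φ′∈ λ a → ∙-cancelʳ (ψ a) (φ a) (φ′ a)
      (trans (sym (canonical-≗ (λ b → φ b ∙ ψ b) a))
        (trans (cong (λ χ → χ a) eq) (canonical-≗ (λ b → φ′ b ∙ ψ b) a))))
    where
    translate : (Fin N → Carrier) → Fin N → Carrier
    translate φ = canonical (λ a → φ a ∙ ψ a)

  Γ-∙ : ∀ {k} (x : Vec (Fin N) k) (φ ψ : Fin N → Carrier) →
        Γ N H x (λ a → φ a ∙ ψ a) ≡ Vec.zipWith _∙_ (Γ N H x φ) (Γ N H x ψ)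
  Γ-∙ []      φ ψ = refl
  Γ-∙ (a ∷ x) φ ψ = cong (_ ∷_) (Γ-∙ x φ ψ)

  -- If ψ lies in the fiber, translation by its inverse injects the fiber into the kernel and
  -- translation by ψ injects the kernel into the fiber; antisymmetry then replaces an explicit
  -- bijection.
  fiber-kerSize : ∀ {k} (x : Vec (Fin N) k) (y : Vec Carrier k) →
                  fiber x y ≡ 𝟙 (inImage? N H x y) * kerSize N H x
  fiber-kerSize {k} x y with inImage? N H x y
  ... | no ¬im = cong length (List.filter-none (λ φ → Vec.≡-dec _≟_ (Γ N H x φ) y)
                    (All.tabulate λ φ∈ eq → ¬im (lose φ∈ eq)))
  ... | yes im = let ψ , ψ∈ , ψx≡y = find im; ψ-hom = homs-sound ψ∈ in
    trans (ℕ.≤-antisym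
      (fiber-translate x (hom-⁻¹ ψ-hom) λ {φ} φx≡y → begin
        Γ N H x (λ a → φ a ∙ (ψ a ⁻¹))                          ≡⟨ Γ-∙ x φ (λ a → ψ a ⁻¹) ⟩
        Vec.zipWith _∙_ (Γ N H x φ) (Γ N H x (λ a → ψ a ⁻¹))
          ≡⟨ cong (λ v → Vec.zipWith _∙_ v _) (trans φx≡y (sym ψx≡y)) ⟩
        Vec.zipWith _∙_ (Γ N H x ψ) (Γ N H x (λ a → ψ a ⁻¹))  ≡⟨ Γ-∙ x ψ (λ a → ψ a ⁻¹) ⟨
        Γ N H x (λ a → ψ a ∙ (ψ a ⁻¹))                          ≡⟨ Vec.map-cong (inverseʳ ∘ ψ) x ⟩
        Vec.map (const ε) x                                   ≡⟨ Vec.map-const x ε ⟩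
        Vec.replicate k ε                                     ∎)
      (fiber-translate x ψ-hom λ {φ} φx≡ε → begin
        Γ N H x (λ a → φ a ∙ ψ a)                             ≡⟨ Γ-∙ x φ ψ ⟩
        Vec.zipWith _∙_ (Γ N H x φ) (Γ N H x ψ)
          ≡⟨ cong (λ v → Vec.zipWith _∙_ v _) (trans φx≡ε (sym (Vec.map-const x ε))) ⟩
        Vec.zipWith _∙_ (Γ N H x (const ε)) (Γ N H x ψ)       ≡⟨ Γ-∙ x (const ε) ψ ⟨
        Γ N H x (λ a → ε ∙ ψ a)                               ≡⟨ Vec.map-cong (identityˡ ∘ ψ) x ⟩
        Γ N H x ψ                                             ≡⟨ ψx≡y ⟩
        y                                                     ∎))
      (sym (ℕ.+-identityʳ _))
    where open ≡-Reasoning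

  agreements : (f φ : Fin N → Carrier) → ℕ
  agreements f φ = count (λ a → f a ≟ φ a) (allFin N)

  ∑-fiber : ∀ k f → ∑ (allVecs (allFin N) k) (λ x → fiber x (Vec.map f x)) ≡ ∑ hs (λ φ → agreements f φ ^ k)
  ∑-fiber k f = begin
    ∑ xs (λ x → fiber x (Vec.map f x))
      ≡⟨ ∑-cong xs (λ {x} _ → count-∑ (λ φ → Vec.≡-dec _≟_ (Γ N H x φ) (Vec.map f x)) hs) ⟩
    ∑ xs (λ x → ∑ hs (λ φ → 𝟙 (Vec.≡-dec _≟_ (Γ N H x φ) (Vec.map f x))))
      ≡⟨ ∑-swap xs hs _ ⟩
    ∑ hs (λ φ → ∑ xs (λ x → 𝟙 (Vec.≡-dec _≟_ (Γ N H x φ) (Vec.map f x))))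
      ≡⟨ ∑-cong hs (λ {φ} _ → count-agreeing-tuples _≟_ f φ (allFin N) k) ⟩
    ∑ hs (λ φ → agreements f φ ^ k)  ∎
    where
    open ≡-Reasoning
    xs = allVecs (allFin N) k

  ∑-kerSize : ∀ k → ∑ (allVecs (allFin N) k) (kerSize N H) ≡ ∑ hs (λ φ → agreements (const ε) φ ^ k)
  ∑-kerSize k = trans
    (∑-cong (allVecs (allFin N) k) (λ {x} _ → cong (fiber x) (sym (Vec.map-const x ε))))
    (∑-fiber k (const ε))

  -- Both sides count pairs of a tuple and a homomorphism, and over each tuple the fiber is no
  -- larger than the kernel.
  ∑-agreements-≤ : ∀ k f → ∑ hs (λ φ → agreements f φ ^ k) ≤ ∑ hs (λ φ → agreements (const ε) φ ^ k)
  ∑-agreements-≤ k f = subst₂ _≤_ (∑-fiber k f) (∑-kerSize k)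
    (∑-mono (allVecs (allFin N) k) (λ {x} _ →
      ℕ.≤-trans (ℕ.≤-reflexive (fiber-kerSize x (Vec.map f x))) (𝟙-*-≤ (inImage? N H x (Vec.map f x)) _)))
    where
    𝟙-*-≤ : {P : Set} (d : Dec P) (m : ℕ) → 𝟙 d * m ≤ m
    𝟙-*-≤ (yes _) m = ℕ.≤-reflexive (ℕ.+-identityʳ m)
    𝟙-*-≤ (no _)  m = z≤n

  -- Since |Hom| ≤ |H| < |H|ᵏ, no Γ is onto, so the test samples from all of Gᵏ.
  𝒢-full : ∀ k → 2 ≤ k → 2 ≤ length elements → 𝒢 N H k ≡ allVecs (allFin N) k
  𝒢-full k 2≤k 2≤s = List.filter-all (inG? N H) (All.tabulate λ {x} _ → not-onto x)
    where
    s = length elements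
    not-onto : (x : Vec (Fin N) k) → Any (λ y → ¬ Any (λ φ → Γ N H x φ ≡ y) hs) (allVecs elements k)
    not-onto x with inG? N H x
    ... | yes x∈𝒢 = x∈𝒢
    -- Membership in the image is decidable, so failing to lie in 𝒢 means that Γ is onto. Then Hᵏ
    -- embeds in the list of images and |H|ᵏ ≤ |H|, against |H| < |H|² ≤ |H|ᵏ.
    ... | no x∉𝒢 = contradiction bound
        (ℕ.<⇒≱ (ℕ.≤-trans (ℕ.m<m*n s s 2≤s) (ℕ.≤-trans (ℕ.≤-reflexive (cong (s *_) (sym (ℕ.*-identityʳ s))))
          (ℕ.^-monoʳ-≤ s 2≤k))))
      where
      instance _ = ℕ.>-nonZero (ℕ.<-trans ℕ.z<s 2≤s)
      onto : ∀ {y} → y ∈ allVecs elements k → y ∈ List.map (Γ N H x) hs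
      onto {y} y∈ with inImage? N H x y
      ... | yes im = let φ , φ∈ , eq = find im in subst (_∈ _) eq (∈-map⁺ (Γ N H x) φ∈)
      ... | no ¬im = contradiction (lose y∈ ¬im) x∉𝒢
      bound : s ^ k ≤ s
      bound = ℕ.≤-trans (ℕ.≤-reflexive (sym (length-allVecs elements k)))
        (ℕ.≤-trans (length-injective (λ y → y) (allVecs-unique elements-unique k) onto (λ _ _ eq → eq))
          (ℕ.≤-trans (ℕ.≤-reflexive (List.length-map (Γ N H x) hs)) length-homs))

  agreements-≗ : ∀ f {φ ψ} → φ ≗ ψ → agreements f φ ≡ agreements f ψ
  agreements-≗ f {φ} {ψ} eq = trans (count-∑ (λ a → f a ≟ φ a) (allFin N))
    (trans (∑-cong (allFin N) (λ {a} _ → cong (λ h → 𝟙 (f a ≟ h)) (eq a)))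
      (sym (count-∑ (λ a → f a ≟ ψ a) (allFin N))))

  agreements-refl : ∀ φ → agreements φ φ ≡ N
  agreements-refl φ = trans (cong length (List.filter-all (λ a → φ a ≟ φ a) {allFin N} (All.tabulate λ _ → refl)))
    (List.length-tabulate {n = N} (λ i → i))

  -- This is the term of the trivial homomorphism, whose kernel is all of G. It makes the
  -- denominator of δₖ positive and is also the final step of the lower bound.
  N^k≤∑-agreements : ∀ k → N ^ k ≤ ∑ hs (λ φ → agreements (const ε) φ ^ k)
  N^k≤∑-agreements k = ℕ.≤-trans
    (ℕ.≤-reflexive (cong (_^ k) (sym (trans (agreements-≗ (const ε) (canonical-≗ (const ε))) (agreements-refl (const ε))))))
    (∑-member hs (λ φ → agreements (const ε) φ ^ k) (homs-complete hom-ε))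

  module _ {p : ℕ} (r : ℕ) (pr : Prime p) (N≡pʳ : N ≡ p ^ r) where

    private instance
      p≢0 = prime⇒nonZero pr

    -- Evaluation at the generator followed by `encodeᴾ` is injective on these homomorphisms.
    torsion-homs : ∀ {qs t} → PrimaryDecomposition H qs → PRank p qs t → ∀ j →
      count (λ φ → (p ^ j · φ (residue 1)) ≟ ε) hs ≤ (p ^ j) ^ t
    torsion-homs {t = t} D R j = ℕ.≤-trans
      (length-injective {ys = allFin ((p ^ j) ^ t)} code (Unique.filter⁺ tors? homs-unique) (λ _ → ∈-allFin _) code-injective)
      (ℕ.≤-reflexive (List.length-tabulate (λ i → i)))
      where
      instance _ = ℕ.m^n≢0 p j
      tors? = λ (φ : Fin N → Carrier) → (p ^ j · φ (residue 1)) ≟ ε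
      code : (Fin N → Carrier) → Fin ((p ^ j) ^ t)
      code φ = encodeᴾ (p ^ j) R (coordinates D (φ (residue 1)))
      code-injective : ∀ {φ ψ} → φ ∈ filter tors? hs → ψ ∈ filter tors? hs → code φ ≡ code ψ → φ ≡ ψ
      code-injective {φ} {ψ} φ∈ ψ∈ eq =
        let φ∈hs , φ-tors = ∈-filter⁻ tors? φ∈
            ψ∈hs , ψ-tors = ∈-filter⁻ tors? ψ∈
        in homs-ext φ∈hs ψ∈hs (hom-determined (homs-sound φ∈hs) (homs-sound ψ∈hs)
             (coordinates-injective D (encodeᴾ-injective pr (PrimaryDecomposition.primePowers D) j R _ _
               (torsion-coordinates D (p ^ j) _ φ-tors) (torsion-coordinates D (p ^ j) _ ψ-tors) eq)))

    -- If the value at the generator has order pʲ, kernel elements are multiples of pʲ below pʳ, and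
    -- dividing by pʲ embeds them in `Fin (p ^ (r ∸ j))`. Hence i = r - j, and r - i is j again.
    kernel-size : ∀ {φ} → Hom φ →
      ∃ λ i → i ≤ r × (p ^ (r ∸ i) · φ (residue 1)) ≡ ε × agreements (const ε) φ ≤ p ^ i
    kernel-size {φ} φ-hom
      with prime-power-order pr r (φ (residue 1)) (trans (cong (_· φ (residue 1)) (sym N≡pʳ)) (hom-annihilated φ-hom))
    ... | j , j≤r , tors , least =
      r ∸ j , ℕ.m∸n≤m r j , trans (cong (λ i → p ^ i · φ (residue 1)) (ℕ.m∸[m∸n]≡n j≤r)) tors ,
      ℕ.≤-trans
        (length-injective {ys = allFin (p ^ (r ∸ j))} quot (Unique.filter⁺ ker? (Unique.allFin⁺ N)) (λ _ → ∈-allFin _)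
          (λ {a} {b} a∈ b∈ eq → toℕ-injective (/-cancelʳ-≡ (pʲ∣ a∈) (pʲ∣ b∈) (fromℕ<-injective _ _ _ _ eq))))
        (ℕ.≤-reflexive (List.length-tabulate (λ i → i)))
      where
      instance _ = ℕ.m^n≢0 p j
      ker? = λ a → ε ≟ φ a
      quot : Fin N → Fin (p ^ (r ∸ j))
      quot a = fromℕ< (m<n*o⇒m/o<n {n = p ^ (r ∸ j)} {p ^ j} (ℕ.<-≤-trans (toℕ<n a)
        (ℕ.≤-reflexive (trans N≡pʳ (trans (cong (p ^_) (sym (ℕ.m∸n+n≡m j≤r))) (ℕ.^-distribˡ-+-* p (r ∸ j) j))))))
      pʲ∣ : ∀ {a} → a ∈ filter ker? (allFin N) → p ^ j ∣ toℕ a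
      pʲ∣ {a} a∈ = least (toℕ a) (trans (sym (hom-toℕ φ-hom a)) (sym (proj₂ (∈-filter⁻ ker? a∈))))

    -- Sorting homomorphisms by order gives Σ_φ |ker φ|ᵐ ≤ Σᵢ pⁱᵐ |H[pʳ⁻ⁱ]| ≤ Σᵢ pⁱᵐ p⁽ʳ⁻ⁱ⁾ᵗ.
    ∑-kernels-bound : ∀ {qs t} → PrimaryDecomposition H qs → PRank p qs t →
      ∀ m q .{{_ : NonZero q}} → q * p ^ t ≤ p ^ m →
      (q ∸ 1) * ∑ hs (λ φ → agreements (const ε) φ ^ m) ≤ q * N ^ m
    ∑-kernels-bound {t = t} D R m q le = ℕ.≤-trans (ℕ.*-monoʳ-≤ (q ∸ 1) (begin
      ∑ hs (λ φ → agreements (const ε) φ ^ m)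
        ≤⟨ ∑-mono hs pointwise ⟩
      ∑ hs (λ φ → ∑ is (λ i → (p ^ i) ^ m * 𝟙 (tors? i φ)))
        ≡⟨ ∑-swap hs is _ ⟩
      ∑ is (λ i → ∑ hs (λ φ → (p ^ i) ^ m * 𝟙 (tors? i φ)))
        ≡⟨ ∑-cong is (λ {i} _ → trans (∑-distribˡ-* hs ((p ^ i) ^ m) _) (cong ((p ^ i) ^ m *_) (sym (count-∑ (tors? i) hs)))) ⟩
      ∑ is (λ i → (p ^ i) ^ m * count (tors? i) hs)
        ≤⟨ ∑-mono is (λ {i} _ → ℕ.*-monoʳ-≤ ((p ^ i) ^ m) (torsion-homs D R (r ∸ i))) ⟩
      ∑ is (λ i → (p ^ i) ^ m * (p ^ (r ∸ i)) ^ t) ∎))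
      (subst (λ M → (q ∸ 1) * ∑ is (λ i → (p ^ i) ^ m * (p ^ (r ∸ i)) ^ t) ≤ q * M ^ m) (sym N≡pʳ)
        (geometric-sum-bound p m t q le r))
      where
      open ℕ.≤-Reasoning
      is = downFrom (suc r)
      tors? : ∀ i (φ : Fin N → Carrier) → Dec ((p ^ (r ∸ i) · φ (residue 1)) ≡ ε)
      tors? i φ = (p ^ (r ∸ i) · φ (residue 1)) ≟ ε
      𝟙-yes : {P : Set} (d : Dec P) → P → 𝟙 d ≡ 1
      𝟙-yes (yes _) _ = refl
      𝟙-yes (no ¬p) p = contradiction p ¬p
      -- The single index supplied by `kernel-size` already dominates the left side; all other terms
      -- are nonnegative.
      pointwise : ∀ {φ} → φ ∈ hs → agreements (const ε) φ ^ m ≤ ∑ is (λ i → (p ^ i) ^ m * 𝟙 (tors? i φ))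
      pointwise {φ} φ∈ =
        let i , i≤r , tors , ker≤ = kernel-size (homs-sound φ∈) in begin
        agreements (const ε) φ ^ m        ≤⟨ ℕ.^-monoˡ-≤ m ker≤ ⟩
        (p ^ i) ^ m                       ≡⟨ ℕ.*-identityʳ ((p ^ i) ^ m) ⟨
        (p ^ i) ^ m * 1                   ≡⟨ cong ((p ^ i) ^ m *_) (𝟙-yes (tors? i φ) tors) ⟨
        (p ^ i) ^ m * 𝟙 (tors? i φ)
          ≤⟨ ∑-member is (λ i → (p ^ i) ^ m * 𝟙 (tors? i φ)) (∈-downFrom⁺ (s≤s i≤r)) ⟩
        ∑ is (λ i → (p ^ i) ^ m * 𝟙 (tors? i φ)) ∎

open import Data.Rational using (_≤_; _*_)

-- The acceptance probability as a ratio of moments, and the two bounds.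

module _ (n : ℕ) (H : FinAbGroup) where
  open FiniteAbelianGroup H
  open CyclicHom n H
  private
    N = suc n
    hs = homs N H

  passProb-moments : ∀ k f → 2 ℕ.≤ k → 2 ℕ.≤ length elements →
    passProb N H k f ≡
      ∑ hs (λ φ → agreements f φ ^ k) ÷ℕ ∑ hs (λ φ → agreements (const ε) φ ^ k)
  passProb-moments k f 2≤k 2≤s = trans
    (cong (λ xs → ∑ (filter (λ x → inImage? N H x (Vec.map f x)) xs) (kerSize N H) ÷ℕ ∑ xs (kerSize N H))
      (𝒢-full k 2≤k 2≤s))
    (cong₂ _÷ℕ_
      (trans (∑-filter (λ x → inImage? N H x (Vec.map f x)) Gᵏ (kerSize N H))
        (trans (∑-cong Gᵏ (λ {x} _ → sym (fiber-kerSize x (Vec.map f x)))) (∑-fiber k f)))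
      (∑-kerSize k))
    where Gᵏ = allVecs (allFin N) k

  module _ {p t k : ℕ} (r : ℕ) {qs : List ℕ} (pr : Prime p) (N≡pʳ : N ≡ p ^ r)
           (D : PrimaryDecomposition H qs) (R : PRank p qs t) (t≥1 : t ≥ 1) (k≥t+2 : k ≥ t + 2)
           (f : Fin N → Carrier) where

    private
      A B K m : ℕ
      A = ∑ hs (λ φ → agreements f φ ^ k)
      B = ∑ hs (λ φ → agreements (const ε) φ ^ k)
      K = ∑ hs (λ φ → agreements (const ε) φ ^ suc t)
      m = k ∸ t ∸ 1
      instance
        p≢0 = prime⇒nonZero pr
        p²≢0 = ℕ.m*n≢0 p p
        p²-1≢0 : ℕ.NonZero (p ℕ.* p ∸ 1)
        p²-1≢0 = ℕ.>-nonZero (ℕ.m<n⇒0<n∸m (ℕ.<-≤-trans (ℕ.nonTrivial⇒n>1 p {{prime⇒nonTrivial pr}}) (ℕ.m≤m*n p p)))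
        B≢0 : ℕ.NonZero B
        B≢0 = ℕ.>-nonZero (ℕ.<-≤-trans (ℕ.m^n>0 N k) (N^k≤∑-agreements k))
        p²B≢0 = ℕ.m*n≢0 (p ℕ.* p) B
        p²-1B≢0 = ℕ.m*n≢0 (p ℕ.* p ∸ 1) B
        Nᵐ≢0 = ℕ.m^n≢0 N m
        Nᵏ≢0 = ℕ.m^n≢0 N k

      2+t≤k : 2 + t ℕ.≤ k
      2+t≤k = subst (ℕ._≤ k) (ℕ.+-comm t 2) k≥t+2

      k≡m+1+t : k ≡ m + suc t
      k≡m+1+t = sym (trans (cong (_+ suc t) (trans (ℕ.∸-+-assoc k t 1) (cong (k ∸_) (ℕ.+-comm t 1))))
        (ℕ.m∸n+n≡m (ℕ.<⇒≤ 2+t≤k)))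

      δ≡A÷B : passProb N H k f ≡ A ÷ℕ B
      δ≡A÷B = passProb-moments k f (ℕ.≤-trans (ℕ.m≤m+n 2 t) 2+t≤k) (size-nontrivial D pr R t≥1)

    max-agreement-lower : Σ (Fin N → Carrier) λ φ → IsHom N H φ ×
      (((p ∸ 1) ℕ.* (p ∸ 1)) ÷ℕ (p ℕ.* p)) * passProb N H k f ≤ agr N H f φ ^ℚ m
    max-agreement-lower = φ* , φ*-hom , subst₂ _≤_
      (sym (trans (cong ((((p ∸ 1) ℕ.* (p ∸ 1)) ÷ℕ (p ℕ.* p)) *_) δ≡A÷B) (÷ℕ-*-÷ℕ ((p ∸ 1) ℕ.* (p ∸ 1)) (p ℕ.* p) A B)))
      (sym (÷ℕ-^ c N m))
      (÷ℕ-mono-≤ ((p ∸ 1) ℕ.* (p ∸ 1) ℕ.* A) (p ℕ.* p ℕ.* B) (c ^ m) (N ^ m) bound)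
      where
      φ* : Fin N → Carrier
      -- The default value competes for the maximum, so it has to be a homomorphism itself; the
      -- trivial one serves.
      φ* = argmax (agreements f) (canonical (const ε)) hs

      φ*-hom : IsHom N H φ*
      φ*-hom = argmax-all (agreements f) {P = IsHom N H} (homs-sound (homs-complete hom-ε)) (All.tabulate homs-sound)

      c : ℕ
      c = agreements f φ*

      A≤cᵐK : A ℕ.≤ c ^ m ℕ.* K
      A≤cᵐK = begin
        A                                                  ≤⟨ ∑-mono hs (λ {φ} φ∈ → begin
          agreements f φ ^ k                               ≡⟨ cong (agreements f φ ^_) k≡m+1+t ⟩
          agreements f φ ^ (m + suc t)                     ≡⟨ ℕ.^-distribˡ-+-* (agreements f φ) m (suc t) ⟩
          agreements f φ ^ m ℕ.* agreements f φ ^ suc t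
            ≤⟨ ℕ.*-monoˡ-≤ _ (ℕ.^-monoˡ-≤ m (All.lookup (f[xs]≤f[argmax] (canonical (const ε)) hs) φ∈)) ⟩
          c ^ m ℕ.* agreements f φ ^ suc t                 ∎) ⟩
        ∑ hs (λ φ → c ^ m ℕ.* agreements f φ ^ suc t)      ≡⟨ ∑-distribˡ-* hs (c ^ m) _ ⟩
        c ^ m ℕ.* ∑ hs (λ φ → agreements f φ ^ suc t)      ≤⟨ ℕ.*-monoʳ-≤ (c ^ m) (∑-agreements-≤ (suc t) f) ⟩
        c ^ m ℕ.* K                                        ∎
        where open ℕ.≤-Reasoning

      bound : (p ∸ 1) ℕ.* (p ∸ 1) ℕ.* A ℕ.* N ^ m ℕ.≤ c ^ m ℕ.* (p ℕ.* p ℕ.* B)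
      bound = begin
        (p ∸ 1) ℕ.* (p ∸ 1) ℕ.* A ℕ.* N ^ m
          ≤⟨ ℕ.*-monoˡ-≤ (N ^ m) (ℕ.*-monoʳ-≤ ((p ∸ 1) ℕ.* (p ∸ 1)) A≤cᵐK) ⟩
        (p ∸ 1) ℕ.* (p ∸ 1) ℕ.* (c ^ m ℕ.* K) ℕ.* N ^ m       ≡⟨ regroup (p ∸ 1) (c ^ m) K (N ^ m) ⟩
        (p ∸ 1) ℕ.* ((p ∸ 1) ℕ.* K) ℕ.* (c ^ m ℕ.* N ^ m)
          -- One factor p - 1 is consumed by the moment bound with q = p; the other is merely
          -- estimated by p, which produces the square in the constant.
          ≤⟨ ℕ.*-monoˡ-≤ _ (ℕ.*-mono-≤ (ℕ.m∸n≤m p 1) (∑-kernels-bound r pr N≡pʳ D R (suc t) p ℕ.≤-refl)) ⟩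
        p ℕ.* (p ℕ.* N ^ suc t) ℕ.* (c ^ m ℕ.* N ^ m)         ≡⟨ regroup′ p (N ^ suc t) (c ^ m) (N ^ m) ⟩
        c ^ m ℕ.* (p ℕ.* p ℕ.* (N ^ m ℕ.* N ^ suc t))
          ≡⟨ cong (λ x → c ^ m ℕ.* (p ℕ.* p ℕ.* x)) (trans (sym (ℕ.^-distribˡ-+-* N m (suc t))) (cong (N ^_) (sym k≡m+1+t))) ⟩
        c ^ m ℕ.* (p ℕ.* p ℕ.* N ^ k)
          ≤⟨ ℕ.*-monoʳ-≤ (c ^ m) (ℕ.*-monoʳ-≤ (p ℕ.* p) (N^k≤∑-agreements k)) ⟩
        c ^ m ℕ.* (p ℕ.* p ℕ.* B)                             ∎
        where
        open ℕ.≤-Reasoning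
        regroup : ∀ a b c d → a ℕ.* a ℕ.* (b ℕ.* c) ℕ.* d ≡ a ℕ.* (a ℕ.* c) ℕ.* (b ℕ.* d)
        regroup = solve-∀
        regroup′ : ∀ a b c d → a ℕ.* (a ℕ.* b) ℕ.* (c ℕ.* d) ≡ c ℕ.* (a ℕ.* a ℕ.* (d ℕ.* b))
        regroup′ = solve-∀

    agreement-upper : (φ : Fin N → Carrier) → IsHom N H φ →
      agr N H f φ ^ℚ k ≤ ((p ℕ.* p) ÷ℕ (p ℕ.* p ∸ 1)) * passProb N H k f
    agreement-upper φ φ-hom = subst₂ _≤_
      (sym (÷ℕ-^ c N k))
      (sym (trans (cong (((p ℕ.* p) ÷ℕ (p ℕ.* p ∸ 1)) *_) δ≡A÷B) (÷ℕ-*-÷ℕ (p ℕ.* p) (p ℕ.* p ∸ 1) A B)))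
      (÷ℕ-mono-≤ (c ^ k) (N ^ k) (p ℕ.* p ℕ.* A) ((p ℕ.* p ∸ 1) ℕ.* B) (begin
        -- Taking q = p², admissible since k - t ≥ 2, gives the constant p² / (p² - 1) uniformly in
        -- k.
        c ^ k ℕ.* ((p ℕ.* p ∸ 1) ℕ.* B)   ≤⟨ ℕ.*-mono-≤ cᵏ≤A (∑-kernels-bound r pr N≡pʳ D R k (p ℕ.* p) p²pᵗ≤pᵏ) ⟩
        A ℕ.* (p ℕ.* p ℕ.* N ^ k)         ≡⟨ regroup A (p ℕ.* p) (N ^ k) ⟩
        p ℕ.* p ℕ.* A ℕ.* N ^ k           ∎))
      where
      open ℕ.≤-Reasoning
      c : ℕ
      c = agreements f φ
      regroup : ∀ a b c → a ℕ.* (b ℕ.* c) ≡ b ℕ.* a ℕ.* c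
      regroup = solve-∀
      cᵏ≤A : c ^ k ℕ.≤ A
      cᵏ≤A = subst (λ x → x ^ k ℕ.≤ A) (agreements-≗ f (canonical-≗ φ))
        (∑-member hs (λ φ → agreements f φ ^ k) (homs-complete φ-hom))
      p²pᵗ≤pᵏ : p ℕ.* p ℕ.* p ^ t ℕ.≤ p ^ k
      p²pᵗ≤pᵏ = ℕ.≤-trans (ℕ.≤-reflexive (ℕ.*-assoc p p (p ^ t))) (ℕ.^-monoʳ-≤ p 2+t≤k)

theorem3p4 : (p r : ℕ) → Prime p → r ≥ 1 →
    (H : FinAbGroup) (qs : List ℕ) → PrimaryDecomposition H qs →
    (t : ℕ) → PRank p qs t → t ≥ 1 →
    (k : ℕ) → k ≥ t + 2 →
    (f : Fin (p ^ r) → FinAbGroup.Carrier H) →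
    let δ = passProb (p ^ r) H k f in
    (Σ (Fin (p ^ r) → FinAbGroup.Carrier H) λ φ → IsHom (p ^ r) H φ ×
    (((((p ∸ 1) ℕ.* (p ∸ 1)) ÷ℕ (p ℕ.* p)) * δ) ≤ (agr (p ^ r) H f φ ^ℚ (k ∸ t ∸ 1))))
    × ((φ : Fin (p ^ r) → FinAbGroup.Carrier H) → IsHom (p ^ r) H φ →
    (agr (p ^ r) H f φ ^ℚ k) ≤ (((p ℕ.* p) ÷ℕ (p ℕ.* p ∸ 1)) * δ))
theorem3p4 p r pr _ H qs D t R t≥1 k k≥t+2 = go (p ^ r) refl
  where
  -- The order is generalised to a variable N so that it can be matched as `suc n`; `p ^ r` is not
  -- of that form, and `f` depends on it through its type.
  go : ∀ N → N ≡ p ^ r → (f : Fin N → FinAbGroup.Carrier H) →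
    (Σ (Fin N → FinAbGroup.Carrier H) λ φ → IsHom N H φ ×
      ((((p ∸ 1) ℕ.* (p ∸ 1)) ÷ℕ (p ℕ.* p)) * passProb N H k f ≤ agr N H f φ ^ℚ (k ∸ t ∸ 1)))
    × ((φ : Fin N → FinAbGroup.Carrier H) → IsHom N H φ →
      agr N H f φ ^ℚ k ≤ ((p ℕ.* p) ÷ℕ (p ℕ.* p ∸ 1)) * passProb N H k f)
  go zero    0≡pʳ f = contradiction (sym 0≡pʳ) (ℕ.≢-nonZero⁻¹ (p ^ r) {{ℕ.m^n≢0 p r {{prime⇒nonZero pr}}}})
  go (suc n) N≡pʳ f = max-agreement-lower n H r pr N≡pʳ D R t≥1 k≥t+2 f ,
    agreement-upper n H r pr N≡pʳ D R t≥1 k≥t+2 f
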